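{- Let $T$ be a Boolean algebra (with order $\le$, meet $\land$, join $\lor$ and complement $\neg$), and let $(a,g)$ and $(a',g')$ be contracts over $T$. Let $\mathcal{C}_q=(a_q,g_q)$ be the quotient $(a,g)/(a',g')$, given by $$a_q=a\land(\neg a'\lor g'),\qquad g_q=(a'\land g)\lor\neg a\lor(a'\land\neg g').$$ Suppose that $a''\in T$ satisfies $a_q\le a''$, and that $g'',g'''\in T$ satisfy $a'\land g'\land g''\le a'\land g'\land g$ and $g'''\land a\le a'\land g''\land a$. Then the contract $(a'',g''')$ is a refinement of $\mathcal{C}_q$, i.e. $(a'',g''')\le\mathcal{C}_q$.
   Context: A contract over a Boolean algebra $T$ (the "term algebra") is a pair $(a,g)$ of elements of $T$, called assumptions and guarantees. Contracts are ordered by refinement: for contracts $\mathcal{C}=(a,g)$ and $\mathcal{C}'=(a',g')$, $\mathcal{C}\le\mathcal{C}'$ (read "$\mathcal{C}$ is a refinement of $\mathcal{C}'$") holds iff $a'\le a$ and $g\lor\neg a\le g'\lor\neg a'$. -}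

module Defs where

open import Data.Product using (_×_)
open import Relation.Binary.Lattice using (BooleanAlgebra)

-- The library's order-theoretic Boolean algebras are Heyting algebras whose
-- implication x ⇨ y is ¬ x ∨ y; this residuation law makes ¬ x a complement
-- of x (x ∧ ¬ x ≈ ⊥ and x ∨ ¬ x ≈ ⊤), and distributivity is derivable.

module Contracts {c ℓ₁ ℓ₂} (T : BooleanAlgebra c ℓ₁ ℓ₂) where
  open BooleanAlgebra T

  infix 4 _≼_
  infix 7 _/_

  record Contract : Set c where
    constructor ⟨_,_⟩
    field
      assumptions : Carrier
      guarantees  : Carrier

  -- C ≼ C′ reads "C is a refinement of C′".
  _≼_ : Contract → Contract → Set ℓ₂
  ⟨ a , g ⟩ ≼ ⟨ a′ , g′ ⟩ = (a′ ≤ a) × (g ∨ ¬ a ≤ g′ ∨ ¬ a′)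

  _/_ : Contract → Contract → Contract
  ⟨ a , g ⟩ / ⟨ a′ , g′ ⟩ =
    ⟨ a ∧ (¬ a′ ∨ g′) , (a′ ∧ g) ∨ ¬ a ∨ (a′ ∧ ¬ g′) ⟩

{-# OPTIONS --safe #-}
module Submission where

open import Defs
open import Data.Product using (_,_)
open import Relation.Binary.Lattice using (BooleanAlgebra)
import Relation.Binary.Lattice.Properties.HeytingAlgebra as HeytingAlgebraProperties
import Relation.Binary.Lattice.Properties.MeetSemilattice as MeetSemilatticeProperties

-- In fact g‴ itself lies below the guarantees of the quotient: split g‴ along a,
-- and then the bound a′ ∧ g″ of g‴ ∧ a along g′; the three pieces lie below ¬ a,
-- a′ ∧ g and a′ ∧ ¬ g′ respectively.

module BooleanAlgebraProperties {c ℓ₁ ℓ₂} (T : BooleanAlgebra c ℓ₁ ℓ₂) where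
  open BooleanAlgebra T
  open HeytingAlgebraProperties heytingAlgebra using (∧-distribˡ-∨-≤; ⇨-applyˡ)
  open MeetSemilatticeProperties meetSemilattice using (∧-monotonic)

  -- Residuating the first bound gives `x ≤ ¬ y ∨ z`, because `y ⇨ z` is by definition `¬ y ∨ z`;
  -- meeting with `x` and distributing leaves only pieces below `z`.
  ≤-split : ∀ {x z} y → x ∧ y ≤ z → x ∧ ¬ y ≤ z → x ≤ z
  ≤-split {x} {z} y x∧y≤z x∧¬y≤z =
    trans (∧-greatest refl (transpose-⇨ x∧y≤z))
      (trans (∧-distribˡ-∨-≤ x (¬ y) z) (∨-least x∧¬y≤z (x∧y≤y x z)))

  ¬-antitone : ∀ {x y} → x ≤ y → ¬ y ≤ ¬ x
  -- On the piece `¬ y ∧ x`, weaken `¬ y` to `¬ y ∨ ¬ x`, which is `y ⇨ ¬ x`; modus ponens with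
  -- `x ≤ y` then yields `¬ x`.
  ¬-antitone {x} {y} x≤y =
    ≤-split x (trans (∧-monotonic (x≤x∨y (¬ y) (¬ x)) refl) (⇨-applyˡ x≤y))
      (x∧y≤y (¬ y) (¬ x))

theorem2 : ∀ {c ℓ₁ ℓ₂} (T : BooleanAlgebra c ℓ₁ ℓ₂) →
    let open BooleanAlgebra T
        open Contracts T
        open Contract in
    (a g a′ g′ a″ g″ g‴ : Carrier) →
    let Cq = ⟨ a , g ⟩ / ⟨ a′ , g′ ⟩ in
    assumptions Cq ≤ a″ →
    a′ ∧ g′ ∧ g″ ≤ a′ ∧ g′ ∧ g →
    g‴ ∧ a ≤ a′ ∧ g″ ∧ a →
    ⟨ a″ , g‴ ⟩ ≼ Cq
theorem2 T a g a′ g′ a″ g″ g‴ aq≤a″ g″-sound g‴-sound =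
  aq≤a″ ,
  -- The two disjuncts are bounded separately: `g‴` by `gq`, and `¬ a″` by the negated assumptions
  -- of the quotient.
  ∨-least (trans g‴≤gq (x≤x∨y _ _)) (trans (¬-antitone aq≤a″) (y≤x∨y _ _))
  where
  open BooleanAlgebra T
  open Contracts T
  open Contract
  open BooleanAlgebraProperties T
  open MeetSemilatticeProperties meetSemilattice using (∧-monotonic)

  gq : Carrier
  gq = guarantees (⟨ a , g ⟩ / ⟨ a′ , g′ ⟩)

  a′∧g″≤gq : a′ ∧ g″ ≤ gq
  a′∧g″≤gq = ≤-split g′
    -- Inside `g′` the meet regroups to `a′ ∧ g′ ∧ g″`, where `g″-sound` applies.
    (trans
      (∧-greatest (trans (x∧y≤x _ _) (x∧y≤x _ _))
        (∧-greatest (x∧y≤y _ _) (trans (x∧y≤x _ _) (x∧y≤y _ _))))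
      (trans g″-sound (trans (∧-monotonic refl (x∧y≤y _ _)) (x≤x∨y _ _))))
    (trans (∧-monotonic (x∧y≤x _ _) refl) (trans (y≤x∨y _ _) (y≤x∨y _ _)))

  g‴≤gq : g‴ ≤ gq
  g‴≤gq = ≤-split a
    (trans g‴-sound (trans (∧-monotonic refl (x∧y≤x _ _)) a′∧g″≤gq))
    (trans (x∧y≤y _ _) (trans (x≤x∨y _ _) (y≤x∨y _ _)))
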